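{- Let $\mathcal{H}=(V,E)$ be a linear hypergraph such that $\mathrm{ar}(\mathcal{H})\ge |V|^{1/2}$. Then $$\mathrm{q}(\mathcal{H})\le \Delta([\mathcal{H}]_2)+1.$$
   Context: A hypergraph $\mathcal{H}=(V,E)$ has a finite vertex set $V$ and a finite set $E$ of nonempty subsets of $V$ (hyperedges). It is linear if $|e\cap e'|\le 1$ for all distinct $e,e'\in E$. The antirank $\mathrm{ar}(\mathcal{H})$ is the minimum cardinality of a hyperedge (set to $\infty$ if $E=\varnothing$). The 2-section $[\mathcal{H}]_2$ is the simple graph on $V$ in which two distinct vertices are adjacent iff some hyperedge contains both; $\Delta([\mathcal{H}]_2)$ is its maximum degree. The chromatic index $\mathrm{q}(\mathcal{H})$ is the least $k$ such that the hyperedges can be colored with $k$ colors so that any two distinct intersecting hyperedges receive different colors. -}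

module Defs where

open import Data.Fin.Base using (Fin)
open import Data.Fin.Properties using (all?; any?) renaming (_≟_ to _≟ᶠ_)
open import Data.Fin.Subset using (Subset; _∈_; _∩_; ∣_∣; Nonempty)
open import Data.Fin.Subset.Properties using (_∈?_; nonempty?)
open import Data.Nat.Base using (ℕ; zero; suc; _*_; _≤_; _⊓_; _⊔_; z≤n; s≤s)
open import Data.Product.Base using (∃; ∃-syntax; _×_; _,_; proj₁; proj₂)
open import Data.Vec.Base as Vec using (Vec; []; _∷_; allFin; count; lookup; tabulate)
open import Data.Vec.Functional using (Vector; foldr)
open import Data.Vec.Properties using (lookup∘tabulate)
open import Function.Base using (id; _∘_)
open import Function.Definitions using (Injective)
open import Level using (0ℓ)
open import Relation.Binary.Core using (Rel)
open import Relation.Binary.Definitions using (Irreflexive; Symmetric)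
  renaming (Decidable to Decidable₂)
open import Relation.Binary.PropositionalEquality
  using (_≡_; _≢_; refl; sym; trans; ≢-sym)
import Relation.Binary.Construct.Add.Supremum.NonStrict as AddSupremum
open import Relation.Nullary.Construct.Add.Supremum using (_⁺; ⊤⁺; [_])
open import Relation.Nullary.Decidable
  using (Dec; yes; no; map′; ¬?; _×-dec_; _→-dec_)
open import Relation.Nullary.Negation using (contradiction)
open import Relation.Unary using (Pred; Decidable)

-- The vertex set is Fin order.  The edge set is the image of the injective
-- family edge, so distinct indices are the same thing as distinct hyperedges.
record Hypergraph : Set where
  field
    order          : ℕ
    size           : ℕ
    edge           : Vector (Subset order) size
    edge-injective : Injective _≡_ _≡_ edge
    edge-nonempty  : ∀ i → Nonempty (edge i)

open Hypergraph public

Linear : Hypergraph → Set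
Linear H = ∀ i j → i ≢ j → ∣ edge H i ∩ edge H j ∣ ≤ 1

ℕ∞ : Set
ℕ∞ = ℕ ⁺

pattern ∞ = ⊤⁺

open AddSupremum _≤_ public using () renaming (_≤⁺_ to _≤∞_)

infixl 7 _⊓∞_
infix  8 _²

_⊓∞_ : ℕ∞ → ℕ∞ → ℕ∞
∞     ⊓∞ b     = b
[ a ] ⊓∞ ∞     = [ a ]
[ a ] ⊓∞ [ b ] = [ a ⊓ b ]

_² : ℕ∞ → ℕ∞
∞     ² = ∞
[ a ] ² = [ a * a ]

antirank : Hypergraph → ℕ∞
antirank H = foldr _⊓∞_ ∞ (λ i → [ ∣ edge H i ∣ ])

-- a ≥√ n says a ≥ n^{1/2}; as a is non-negative this means n ≤ a².
infix 4 _≥√_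

_≥√_ : ℕ∞ → ℕ → Set
a ≥√ n = [ n ] ≤∞ a ²

record SimpleGraph (n : ℕ) : Set₁ where
  field
    Adj        : Rel (Fin n) 0ℓ
    adj?       : Decidable₂ Adj
    adj-sym    : Symmetric Adj
    adj-irrefl : Irreflexive _≡_ Adj

  degree : Fin n → ℕ
  degree v = count (adj? v) (allFin n)

  -- The maximum degree of the graph with no vertices is 0.
  Δ : ℕ
  Δ = foldr _⊔_ 0 degree

open SimpleGraph public

[_]₂ : (H : Hypergraph) → SimpleGraph (order H)
[ H ]₂ = record
  { Adj        = λ u v → u ≢ v × (∃[ i ] u ∈ edge H i × v ∈ edge H i)
  ; adj?       = λ u v → ¬? (u ≟ᶠ v) ×-dec
                         any? (λ i → (u ∈? edge H i) ×-dec (v ∈? edge H i))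
  ; adj-sym    = λ { (u≢v , i , u∈ , v∈) → ≢-sym u≢v , i , v∈ , u∈ }
  ; adj-irrefl = λ { u≡v (u≢v , _) → u≢v u≡v }
  }

IsProper : (H : Hypergraph) {k : ℕ} → (Fin (size H) → Fin k) → Set
IsProper H c = ∀ i j → i ≢ j → Nonempty (edge H i ∩ edge H j) → c i ≢ c j

EdgeColourable : Hypergraph → Pred ℕ 0ℓ
EdgeColourable H k = ∃[ c ] IsProper H {k} c

IsLeast : Pred ℕ 0ℓ → Pred ℕ 0ℓ
IsLeast P m = P m × (∀ j → P j → m ≤ j)

least : {P : Pred ℕ 0ℓ} → Decidable P → ∀ k → P k → ∃ (IsLeast P)
least P? zero    p = 0 , p , λ _ _ → z≤n
least P? (suc k) p with P? 0
... | yes p₀ = 0 , p₀ , λ _ _ → z≤n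
... | no ¬p₀ with least (P? ∘ suc) k p
...   | m , pm , lb = suc m , pm , λ where
        zero    q → contradiction q ¬p₀
        (suc j) q → s≤s (lb j q)

anyVec? : ∀ {k} m {P : Pred (Vec (Fin k) m) 0ℓ} → Decidable P → Dec (∃ P)
anyVec? zero    P? = map′ ([] ,_) (λ { ([] , p) → p }) (P? [])
anyVec? (suc m) P? =
  map′ (λ { (x , xs , p) → x ∷ xs , p }) (λ { (x ∷ xs , p) → x , xs , p })
       (any? (λ x → anyVec? m (λ xs → P? (x ∷ xs))))

isProper? : (H : Hypergraph) {k : ℕ} → Decidable (IsProper H {k})
isProper? H c = all? λ i → all? λ j →
  ¬? (i ≟ᶠ j) →-dec (nonempty? (edge H i ∩ edge H j) →-dec ¬? (c i ≟ᶠ c j))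

edgeColourable? : (H : Hypergraph) → Decidable (EdgeColourable H)
edgeColourable? H k = map′
  (λ { (v , p) → lookup v , p })
  (λ { (c , p) → tabulate c , λ i j i≢j i∩j eq →
         p i j i≢j i∩j (trans (sym (lookup∘tabulate c i))
                              (trans eq (lookup∘tabulate c j))) })
  (anyVec? (size H) (λ v → isProper? H (lookup v)))

chromaticIndex-exists : (H : Hypergraph) → ∃ (IsLeast (EdgeColourable H))
chromaticIndex-exists H =
  least (edgeColourable? H) (size H) (id , λ _ _ i≢j _ → i≢j)

q : Hypergraph → ℕ
q H = proj₁ (chromaticIndex-exists H)

q-isLeast : (H : Hypergraph) → IsLeast (EdgeColourable H) (q H)
q-isLeast H = proj₂ (chromaticIndex-exists H)

{-# OPTIONS --safe #-}
-- Colour the edges greedily in order of decreasing size.  Let r be the size of an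
-- edge e and D + 1 = ⌊Δ / (r - 1)⌋.  By linearity a vertex of e lies on at most
-- D + 1 edges of size at least r, so e meets at most r D edges coloured before it,
-- which is at most Δ if D < r.  Otherwise Δ ≤ |V| - 1 ≤ r² - 1 forces D = r and
-- Δ + 1 = |V| = r², and greedy can fail at e only if H looks like an affine plane
-- around e: every vertex of e lies on r further edges and is adjacent to all other
-- vertices.  Then the edges disjoint from e are pairwise disjoint and share a
-- colour with e, two of the r² edges meeting e are disjoint and share a colour, and
-- all remaining edges get their own colour, which makes r² = Δ + 1 colours.

module Submission where

open import Data.Bool.Base using (true; false; if_then_else_)
open import Data.Fin.Base using (Fin; zero; suc)
open import Data.Fin.Properties using (any?; toℕ<n; ¬∀⟶∃¬) renaming (_≟_ to _≟ᶠ_)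
open import Data.Fin.Subset using (Subset; _∈_; _∩_; ∣_∣; inside; outside)
open import Data.Fin.Subset.Properties using (_∈?_; x∈p∩q⁺; x∈p∩q⁻; ⊆-antisym)
open import Data.List.Base as List using (List)
open import Data.List.Membership.Propositional using () renaming (_∈_ to _∈ˡ_)
open import Data.List.Membership.Propositional.Properties using (∈-allFin)
open import Data.List.Relation.Binary.Permutation.Propositional using (↭-sym)
open import Data.List.Relation.Binary.Permutation.Propositional.Properties using (∈-resp-↭)
open import Data.List.Relation.Unary.All as All using ()
open import Data.List.Relation.Unary.AllPairs as AllPairs using (AllPairs)
open import Data.List.Relation.Unary.Any using (here; there)
open import Data.List.Relation.Unary.Linked.Properties using (Linked⇒AllPairs)
import Data.List.Sort as Sort
open import Data.Nat.Base using (ℕ; zero; suc; pred; _≤_; _<_; _+_; _*_; _⊔_; z≤n; s≤s; >-nonZero)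
open import Data.Nat.DivMod using (_/_; m*n/n≡m; m/n*n≤m; /-monoˡ-≤)
open import Data.Nat.Properties
open import Data.Nat.Tactic.RingSolver using (solve-∀)
open import Data.Product.Base using (∃; _×_; _,_; proj₁; proj₂)
open import Data.Sum.Base using (_⊎_; inj₁; inj₂)
open import Data.Vec.Base using ([]; _∷_; count; tabulate)
open import Data.Vec.Functional using (Vector; foldr; updateAt)
open import Data.Vec.Functional.Properties using (updateAt-updates; updateAt-minimal)
open import Algebra.Properties.Semiring.Sum +-*-semiring
  using (sum; ∑-distrib-+; ∑-comm; *-distribʳ-sum)
open import Function.Base using (id; _∘_; const)
open import Level using (0ℓ)
open import Relation.Binary.Construct.On as On using ()
open import Relation.Binary.Core using (Rel)
open import Relation.Binary.Definitions using (Symmetric; Irreflexive)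
  renaming (Decidable to Decidable₂)
open import Relation.Binary.PropositionalEquality
  using (_≡_; _≢_; refl; sym; trans; cong; subst; ≢-sym)
open import Relation.Binary.Construct.Add.Supremum.NonStrict _≤_ using ([_]; _≤⊤⁺; [≤]-injective)
open import Relation.Nullary.Construct.Add.Supremum using ([_])
open import Relation.Nullary.Decidable
  using (Dec; yes; no; does; ¬?; _×-dec_; _⊎-dec_; decidable-stable)
open import Relation.Nullary.Negation using (¬_; contradiction)
open import Relation.Unary using (Pred; Decidable)
open import Defs

private
  variable
    m n : ℕ
    A B C : Set

-- Cardinalities of decidable subsets

indicator : Dec A → ℕ
indicator a = if does a then 1 else 0

-- A sum of indicators, so that double counting becomes the exchange of two finite sums.
card : {P : Pred (Fin n) 0ℓ} → Decidable P → ℕ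
card P? = sum (λ i → indicator (P? i))

indicator-≤-+ : (a : Dec A) (b : Dec B) (c : Dec C) → (A → B ⊎ C) →
                indicator a ≤ indicator b + indicator c
indicator-≤-+ (no  _) _       _       _ = z≤n
indicator-≤-+ (yes _) (yes _) _       _ = s≤s z≤n
indicator-≤-+ (yes _) (no  _) (yes _) _ = s≤s z≤n
indicator-≤-+ (yes a) (no ¬b) (no ¬c) f with f a
... | inj₁ b = contradiction b ¬b
... | inj₂ c = contradiction c ¬c

indicator-+-≤ : (a : Dec A) (b : Dec B) (c : Dec C) →
                (A → C) → (B → C) → (A → ¬ B) →
                indicator a + indicator b ≤ indicator c
indicator-+-≤ (no  _) (no  _) _       _ _ _ = z≤n
indicator-+-≤ (yes a) (yes b) _       _ _ d = contradiction b (d a)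
indicator-+-≤ (yes _) (no  _) (yes _) _ _ _ = s≤s z≤n
indicator-+-≤ (no  _) (yes _) (yes _) _ _ _ = s≤s z≤n
indicator-+-≤ (yes a) (no  _) (no ¬c) f _ _ = contradiction (f a) ¬c
indicator-+-≤ (no  _) (yes b) (no ¬c) _ g _ = contradiction (g b) ¬c

sum-mono : {f g : Vector ℕ n} → (∀ i → f i ≤ g i) → sum f ≤ sum g
sum-mono {zero}  f≤g = z≤n
sum-mono {suc n} f≤g = +-mono-≤ (f≤g zero) (sum-mono (f≤g ∘ suc))

card-≤-+ : {P Q R : Pred (Fin n) 0ℓ}
           (P? : Decidable P) (Q? : Decidable Q) (R? : Decidable R) →
           (∀ {i} → P i → Q i ⊎ R i) → card P? ≤ card Q? + card R?
card-≤-+ P? Q? R? P⊆Q∪R = ≤-trans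
  (sum-mono λ i → indicator-≤-+ (P? i) (Q? i) (R? i) P⊆Q∪R)
  (≤-reflexive (∑-distrib-+ (indicator ∘ Q?) (indicator ∘ R?)))

card-+-≤ : {P Q R : Pred (Fin n) 0ℓ}
           (P? : Decidable P) (Q? : Decidable Q) (R? : Decidable R) →
           (∀ {i} → P i → R i) → (∀ {i} → Q i → R i) → (∀ {i} → P i → ¬ Q i) →
           card P? + card Q? ≤ card R?
card-+-≤ P? Q? R? P⊆R Q⊆R P∩Q=∅ = ≤-trans
  (≤-reflexive (sym (∑-distrib-+ (indicator ∘ P?) (indicator ∘ Q?))))
  (sum-mono λ i → indicator-+-≤ (P? i) (Q? i) (R? i) P⊆R Q⊆R P∩Q=∅)

card-mono : {P Q : Pred (Fin n) 0ℓ}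
            (P? : Decidable P) (Q? : Decidable Q) →
            (∀ {i} → P i → Q i) → card P? ≤ card Q?
card-mono P? Q? P⊆Q = ≤-trans (m≤m+n (card P?) (card P?′))
  (card-+-≤ P? P?′ Q? P⊆Q (P⊆Q ∘ proj₁) (λ p (_ , ¬p) → ¬p p))
  -- An empty set: monotonicity is the bound for disjoint unions with one empty part.
  where P?′ = λ i → P? i ×-dec ¬? (P? i)

card-empty : {P : Pred (Fin n) 0ℓ}
             (P? : Decidable P) → (∀ i → ¬ P i) → card P? ≡ 0
card-empty {n = zero}  P? ¬P = refl
card-empty {n = suc n} P? ¬P with P? zero
... | yes p = contradiction p (¬P zero)
... | no  _ = card-empty (P? ∘ suc) (¬P ∘ suc)

card-full : {P : Pred (Fin n) 0ℓ}
            (P? : Decidable P) → (∀ i → P i) → card {n} P? ≡ n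
card-full {n = zero}  P? p = refl
card-full {n = suc n} P? p with P? zero
... | yes _  = cong suc (card-full (P? ∘ suc) (p ∘ suc))
... | no  ¬p = contradiction (p zero) ¬p

card-≤ : {P : Pred (Fin n) 0ℓ}
         (P? : Decidable P) → card {n} P? ≤ n
card-≤ {n = zero}  P? = z≤n
card-≤ {n = suc n} P? with P? zero
... | yes _ = s≤s (card-≤ (P? ∘ suc))
... | no  _ = m≤n⇒m≤1+n (card-≤ (P? ∘ suc))

card-singleton : (i : Fin n) → card (_≟ᶠ i) ≡ 1
card-singleton {suc n} zero = cong suc (card-empty {n = n} (λ i → suc i ≟ᶠ zero) (λ _ ()))
card-singleton {suc n} (suc i) = ≤-antisym
  (≤-trans (card-mono (λ j → suc j ≟ᶠ suc i) (_≟ᶠ i) λ { refl → refl })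
           (≤-reflexive (card-singleton i)))
  (≤-trans (≤-reflexive (sym (card-singleton i)))
           (card-mono (_≟ᶠ i) (λ j → suc j ≟ᶠ suc i) (cong suc)))

card-≥1 : {P : Pred (Fin n) 0ℓ}
          (P? : Decidable P) (i : Fin n) → P i → 1 ≤ card P?
card-≥1 P? i p = ≤-trans (≤-reflexive (sym (card-singleton i)))
  (card-mono (_≟ᶠ i) P? λ { refl → p })

card-≤1 : {P : Pred (Fin n) 0ℓ}
          (P? : Decidable P) → (∀ {i j} → P i → P j → i ≡ j) → card P? ≤ 1
card-≤1 P? unique with any? P?
... | yes (i , p) = ≤-trans (card-mono P? (_≟ᶠ i) (λ q → unique q p))
                            (≤-reflexive (card-singleton i))
... | no  ¬p      = ≤-trans (≤-reflexive (card-empty P? λ i p → ¬p (i , p))) z≤n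

card-<⇒∃¬ : {P : Pred (Fin n) 0ℓ}
            (P? : Decidable P) → card {n} P? < n → ∃ λ i → ¬ P i
card-<⇒∃¬ {P = P} P? P<n =
  ¬∀⟶∃¬ _ P P? λ all → <-irrefl (card-full P? all) P<n

card-insert-≤ : {P Q : Pred (Fin n) 0ℓ}
                (P? : Decidable P) (Q? : Decidable Q) (i : Fin n) →
                (∀ {j} → P j → Q j) → Q i → ¬ P i → card P? + 1 ≤ card Q?
card-insert-≤ P? Q? i P⊆Q q ¬p = subst (λ k → card P? + k ≤ card Q?) (card-singleton i)
  (card-+-≤ P? (_≟ᶠ i) Q? P⊆Q (λ { refl → q }) (λ { p refl → ¬p p }))

card-≤-insert : {P Q : Pred (Fin n) 0ℓ}
                (P? : Decidable P) (Q? : Decidable Q) (i : Fin n) →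
                (∀ {j} → P j → j ≢ i → Q j) → card P? ≤ card Q? + 1
card-≤-insert {P = P} {Q = Q} P? Q? i P⊆Q =
  subst (λ k → card P? ≤ card Q? + k) (card-singleton i) (card-≤-+ P? Q? (_≟ᶠ i) split)
  where
  split : ∀ {j} → P j → Q j ⊎ j ≡ i
  split {j} p with j ≟ᶠ i
  ... | yes j≡i = inj₂ j≡i
  ... | no  j≢i = inj₁ (P⊆Q p j≢i)

card-missing : {P : Pred (Fin n) 0ℓ}
               (P? : Decidable P) (i : Fin n) → ¬ P i → card P? + 1 ≤ n
card-missing P? i ¬p = ≤-trans
  (card-insert-≤ P? P∪i? i inj₁ (inj₂ refl) ¬p) (card-≤ P∪i?)
  where P∪i? = λ j → P? j ⊎-dec (j ≟ᶠ i)

card-missing₂ : {P : Pred (Fin n) 0ℓ}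
                (P? : Decidable P) (i j : Fin n) → i ≢ j → ¬ P i → ¬ P j → card P? + 1 + 1 ≤ n
card-missing₂ P? i j i≢j ¬pi ¬pj = ≤-trans
  (+-monoˡ-≤ 1 (card-insert-≤ P? P∪i? i inj₁ (inj₂ refl) ¬pi))
  (card-missing P∪i? j λ { (inj₁ pj) → ¬pj pj ; (inj₂ j≡i) → i≢j (sym j≡i) })
  where P∪i? = λ k → P? k ⊎-dec (k ≟ᶠ i)

count-tabulate : {P : Pred (Fin n) 0ℓ} (P? : Decidable P) (f : Fin m → Fin n) →
                 count P? (tabulate f) ≡ card (P? ∘ f)
count-tabulate {m = zero}  P? f = refl
count-tabulate {m = suc m} P? f with does (P? (f zero))
... | true  = cong suc (count-tabulate P? (f ∘ suc))
... | false = count-tabulate P? (f ∘ suc)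

∣p∣≡card : (p : Subset n) → ∣ p ∣ ≡ card (_∈? p)
∣p∣≡card []            = refl
∣p∣≡card (inside  ∷ p) = cong suc (∣p∣≡card p)
∣p∣≡card (outside ∷ p) = ∣p∣≡card p

-- The pairs in `R` are counted by rows and by columns; columns outside `Q` contain none.
double-count : {R : Fin m → Fin n → Set} {P : Pred (Fin m) 0ℓ} {Q : Pred (Fin n) 0ℓ}
               (R? : Decidable₂ R) (P? : Decidable P) (Q? : Decidable Q) (k l : ℕ) →
               (∀ i → P i → k ≤ card (R? i)) →
               (∀ j → Q j → card (λ i → R? i j) ≤ l) →
               (∀ {i j} → R i j → Q j) →
               card P? * k ≤ card Q? * l
double-count {R = R} {P} {Q} R? P? Q? k l k≤ ≤l R⊆Q = begin
  card P? * k                          ≡⟨ *-distribʳ-sum k (indicator ∘ P?) ⟩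
  sum (λ i → indicator (P? i) * k)     ≤⟨ sum-mono row ⟩
  sum (λ i → card (R? i))              ≡⟨ ∑-comm (λ i j → indicator (R? i j)) ⟩
  sum (λ j → card (λ i → R? i j))      ≤⟨ sum-mono column ⟩
  sum (λ j → indicator (Q? j) * l)     ≡⟨ *-distribʳ-sum l (indicator ∘ Q?) ⟨
  card Q? * l                          ∎
  where
  open ≤-Reasoning
  row : ∀ i → indicator (P? i) * k ≤ card (R? i)
  row i with P? i
  ... | yes p = ≤-trans (≤-reflexive (+-identityʳ k)) (k≤ i p)
  ... | no  _ = z≤n
  column : ∀ j → card (λ i → R? i j) ≤ indicator (Q? j) * l
  column j with Q? j
  ... | yes q = ≤-trans (≤l j q) (≤-reflexive (sym (+-identityʳ l)))
  ... | no ¬q = ≤-reflexive (card-empty (λ i → R? i j) (λ i r → ¬q (R⊆Q r)))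

-- The case k = l = 1: an injection from `P` into `Q` given as a relation, so that no partner has to
-- be chosen as a function.
double-count₁ : {R : Fin m → Fin n → Set} {P : Pred (Fin m) 0ℓ} {Q : Pred (Fin n) 0ℓ}
                (R? : Decidable₂ R) (P? : Decidable P) (Q? : Decidable Q) →
                (∀ i → P i → ∃ (R i)) →
                (∀ {i i′ j} → R i j → R i′ j → i ≡ i′) →
                (∀ {i j} → R i j → Q j) →
                card P? ≤ card Q?
double-count₁ R? P? Q? total unique R⊆Q = *-cancelʳ-≤ (card P?) (card Q?) 1
  (double-count R? P? Q? 1 1
    (λ i p → let j , r = total i p in card-≥1 (R? i) j r)
    (λ j _ → card-≤1 (λ i → R? i j) unique)
    R⊆Q)

-- Greedy colouring

module Greedy {m : ℕ} {Conflict : Rel (Fin m) 0ℓ} (conflict? : Decidable₂ Conflict)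
              (conflict-sym : Symmetric Conflict)
              (conflict-irrefl : Irreflexive _≡_ Conflict)
              (weight : Fin m → ℕ) (K : ℕ) where

  -- Ties count as heavier, so whatever the order among equal weights, every neighbour coloured
  -- before `i` is counted.
  heavier? : ∀ i → Decidable (λ j → Conflict i j × weight i ≤ weight j)
  heavier? i j = conflict? i j ×-dec (weight i ≤? weight j)

  module _ (bound : ∀ i → card (heavier? i) ≤ K) where

    -- The heavier neighbours use at most `K` of the `suc K` colours. Since `c` is total, those not
    -- yet treated carry a default colour; avoiding it too costs nothing, as `bound` counts them as
    -- well.
    fresh : (c : Fin m → Fin (suc K)) (i : Fin m) →
            ∃ λ k → ∀ j → Conflict i j → weight i ≤ weight j → c j ≢ k
    fresh c i with card-<⇒∃¬ used? (s≤s (≤-trans used≤ (bound i)))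
      where
      used? : Decidable (λ k → ∃ λ j → (Conflict i j × weight i ≤ weight j) × c j ≡ k)
      used? k = any? (λ j → heavier? i j ×-dec (c j ≟ᶠ k))
      used≤ : card used? ≤ card (heavier? i)
      used≤ = double-count₁ (λ k j → heavier? i j ×-dec (c j ≟ᶠ k)) used? (heavier? i)
        (λ k used → used) (λ (_ , eq) (_ , eq′) → trans (sym eq) eq′) proj₁
    ... | k , ¬used = k , λ j cij wij eq → ¬used (j , (cij , wij) , eq)

    -- The tail is coloured before the head, so on a list of increasing weight the heavy elements
    -- come first, and at its turn `x` only has to avoid heavier neighbours.
    colour-list : (xs : List (Fin m)) → AllPairs (λ i j → weight i ≤ weight j) xs →
                  ∃ λ (c : Fin m → Fin (suc K)) →
                  ∀ {i j} → i ∈ˡ xs → j ∈ˡ xs → Conflict i j → c i ≢ c j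
    colour-list List.[]       _ = const zero , λ ()
    colour-list (x List.∷ xs) (x≤xs AllPairs.∷ sorted) =
      updateAt c x (const k) , proper
      where
      c = proj₁ (colour-list xs sorted)
      k = proj₁ (fresh c x)
      fresh-x : ∀ {j} → j ∈ˡ xs → Conflict x j → c j ≢ k
      fresh-x {j} j∈ xj = proj₂ (fresh c x) j xj (All.lookup x≤xs j∈)
      tail-∈ : ∀ {i} → i ∈ˡ (x List.∷ xs) → i ≢ x → i ∈ˡ xs
      tail-∈ (here i≡x)  i≢x = contradiction i≡x i≢x
      tail-∈ (there i∈)  _   = i∈
      proper : ∀ {i j} → i ∈ˡ (x List.∷ xs) → j ∈ˡ (x List.∷ xs) → Conflict i j →
               updateAt c x (const k) i ≢ updateAt c x (const k) j
      proper {i} {j} i∈ j∈ ij eq with i ≟ᶠ x | j ≟ᶠ x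
      ... | yes refl | yes refl = conflict-irrefl refl ij
      ... | yes refl | no  j≢x  = fresh-x (tail-∈ j∈ j≢x) ij
        (trans (sym (updateAt-minimal j x c j≢x)) (trans (sym eq) (updateAt-updates x c)))
      ... | no  i≢x  | yes refl = fresh-x (tail-∈ i∈ i≢x) (conflict-sym ij)
        (trans (sym (updateAt-minimal i x c i≢x)) (trans eq (updateAt-updates x c)))
      ... | no  i≢x  | no  j≢x  =
        proj₂ (colour-list xs sorted) (tail-∈ i∈ i≢x) (tail-∈ j∈ j≢x) ij
          (trans (sym (updateAt-minimal i x c i≢x)) (trans eq (updateAt-minimal j x c j≢x)))

    open Sort (On.decTotalOrder ≤-decTotalOrder weight) using (sort; sort-↭; sort-↗)

    colour : ∃ λ (c : Fin m → Fin (suc K)) → ∀ i j → Conflict i j → c i ≢ c j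
    colour = let c , proper = colour-list (sort all) (Linked⇒AllPairs ≤-trans (sort-↗ all))
             in c , λ i j → proper (∈sort i) (∈sort j)
      where
      all = List.allFin m
      ∈sort : ∀ i → i ∈ˡ sort all
      ∈sort i = ∈-resp-↭ (↭-sym (sort-↭ all)) (∈-allFin i)

-- Numerical bounds

foldr-⊔-upper : (f : Vector ℕ n) (i : Fin n) → f i ≤ foldr _⊔_ 0 f
foldr-⊔-upper f zero    = m≤m⊔n (f zero) _
foldr-⊔-upper f (suc i) = ≤-trans (foldr-⊔-upper (f ∘ suc) i) (m≤n⊔m (f zero) _)

-- The hypothesis `0 < m` handles the default value 0 of the empty maximum.
foldr-⊔-< : (f : Vector ℕ n) → 0 < m → (∀ i → f i < m) → foldr _⊔_ 0 f < m
foldr-⊔-< {n = zero}  f 0<m f<m = 0<m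
foldr-⊔-< {n = suc n} f 0<m f<m = ⊔-lub (f<m zero) (foldr-⊔-< (f ∘ suc) 0<m (f<m ∘ suc))

≥√-⊓∞ : ∀ a b → a ⊓∞ b ≥√ n → a ≥√ n × b ≥√ n
≥√-⊓∞ ∞     b     b≥ = (_ ≤⊤⁺) , b≥
≥√-⊓∞ [ a ] ∞     a≥ = a≥ , (_ ≤⊤⁺)
≥√-⊓∞ [ a ] [ b ] [ n≤ ] =
  [ ≤-trans n≤ (*-mono-≤ (m⊓n≤m a b) (m⊓n≤m a b)) ] ,
  [ ≤-trans n≤ (*-mono-≤ (m⊓n≤n a b) (m⊓n≤n a b)) ]

-- Turns the antirank hypothesis into a bound on the size of every single edge.
foldr-⊓∞-≥√ : (f : Vector ℕ∞ m) → foldr _⊓∞_ ∞ f ≥√ n → ∀ i → f i ≥√ n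
foldr-⊓∞-≥√ f ≥√ zero    = proj₁ (≥√-⊓∞ (f zero) _ ≥√)
foldr-⊓∞-≥√ f ≥√ (suc i) = foldr-⊓∞-≥√ (f ∘ suc) (proj₂ (≥√-⊓∞ (f zero) _ ≥√)) i

-- This is r² = (r + 1)(r - 1) + 1 for an edge size r = 2 + s, a form that avoids subtraction.
square-of-2+ : ∀ s → (2 + s) * (2 + s) ≡ (3 + s) * (1 + s) + 1
square-of-2+ = solve-∀

-- Meant for `k` edges of size at least r = 2 + s through one vertex: they cover at least k(r - 1) +
-- 1 of at most r² vertices.
star-size : ∀ s k → k * (1 + s) + 1 ≤ (2 + s) * (2 + s) → k ≤ 3 + s
star-size s k le = *-cancelʳ-≤ k (3 + s) (1 + s)
  (+-cancelʳ-≤ 1 _ _ (≤-trans le (≤-reflexive (square-of-2+ s))))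

-- Equality must hold throughout when the greedy bound (2 + s) * D exceeds Δ.
tight : ∀ s D {Δ N n} → Δ < N → N ≤ (2 + s) * D → (1 + D) * (1 + s) ≤ Δ →
        Δ + 1 ≤ n → n ≤ (2 + s) * (2 + s) →
        D ≡ 2 + s × n ≡ (2 + s) * (2 + s) × Δ + 1 ≡ n
tight s D {Δ} {N} {n} Δ<N N≤ ≤Δ Δ<n n≤ = D≡ , ≤-antisym n≤ (≤-trans square≤ Δ<n) ,
                                           ≤-antisym Δ<n (≤-trans n≤ square≤)
  where
  open ≤-Reasoning
  swap : ∀ s D → D + (1 + s) * D + (1 + s) ≡ D + ((1 + D) * (1 + s))
  swap = solve-∀
  -- With r = 2 + s, the chain (1 + D)(r - 1) ≤ Δ < rD leaves r - 1 < D.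
  s<D : 2 + s ≤ D
  s<D = +-cancelˡ-≤ ((2 + s) * D) (2 + s) D (begin
    (2 + s) * D + (2 + s)     ≡⟨ +-suc _ _ ⟩
    suc ((2 + s) * D + (1 + s)) ≡⟨ cong suc (swap s D) ⟩
    suc (D + (1 + D) * (1 + s)) ≤⟨ s≤s (+-monoʳ-≤ D ≤Δ) ⟩
    suc (D + Δ)               ≡⟨ sym (+-suc D Δ) ⟩
    D + suc Δ                 ≤⟨ +-monoʳ-≤ D (≤-trans Δ<N N≤) ⟩
    D + (2 + s) * D           ≡⟨ +-comm D _ ⟩
    (2 + s) * D + D           ∎)
  D≡ : D ≡ 2 + s
  D≡ = ≤-antisym
    (≤-pred (star-size s (1 + D) (≤-trans (+-monoˡ-≤ 1 ≤Δ) (≤-trans Δ<n n≤)))) s<D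
  square≤ : (2 + s) * (2 + s) ≤ Δ + 1
  square≤ = begin
    (2 + s) * (2 + s)         ≡⟨ square-of-2+ s ⟩
    (3 + s) * (1 + s) + 1     ≡⟨ cong (λ d → (1 + d) * (1 + s) + 1) (sym D≡) ⟩
    (1 + D) * (1 + s) + 1     ≤⟨ +-monoˡ-≤ 1 ≤Δ ⟩
    Δ + 1                     ∎

Fin-≤1-unique : n ≤ 1 → (i j : Fin n) → i ≡ j
Fin-≤1-unique (s≤s z≤n) zero zero = refl

-- Linear hypergraphs

module _ (H : Hypergraph) where

  private
    E = edge H
    deg = degree [ H ]₂
    ΔH = Δ [ H ]₂

  -- Unlike `Conflict` this is reflexive, edges being nonempty, so an edge counts among those
  -- meeting it.
  Meets : Rel (Fin (size H)) 0ℓ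
  Meets f g = ∃ λ v → v ∈ E f × v ∈ E g

  Meets-sym : Symmetric Meets
  Meets-sym (v , v∈f , v∈g) = v , v∈g , v∈f

  meets? : Decidable₂ Meets
  meets? f g = any? λ v → (v ∈? E f) ×-dec (v ∈? E g)

  Conflict : Rel (Fin (size H)) 0ℓ
  Conflict f g = f ≢ g × Meets f g

  conflict? : Decidable₂ Conflict
  conflict? f g = ¬? (f ≟ᶠ g) ×-dec meets? f g

  private
    EdgeColouring = ∃ λ (c : Fin (size H) → Fin (suc ΔH)) → ∀ i j → Conflict i j → c i ≢ c j

  open Greedy conflict? (λ (f≢g , f⋈g) → ≢-sym f≢g , Meets-sym f⋈g)
              (λ f≡g (f≢g , _) → f≢g f≡g) (λ f → ∣ E f ∣) ΔH
    using () renaming (heavier? to heavier-neighbour?; colour to greedy-colour)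

  deg+1≤order : ∀ v → deg v + 1 ≤ order H
  deg+1≤order v = subst (λ d → d + 1 ≤ order H) (sym (count-tabulate (adj? [ H ]₂ v) id))
    (card-missing (adj? [ H ]₂ v) v λ (v≢v , _) → v≢v refl)

  deg≤Δ : ∀ v → deg v ≤ ΔH
  deg≤Δ = foldr-⊔-upper deg

  -- Consequences of linearity

  module _ (linear : Linear H) where

    common-vertex-unique : ∀ {f g u v} → f ≢ g → u ∈ E f → v ∈ E f → u ∈ E g → v ∈ E g → u ≡ v
    common-vertex-unique {f} {g} {u} {v} f≢g uf vf ug vg = decidable-stable (u ≟ᶠ v) λ u≢v →
      <⇒≱ (≤-trans (+-mono-≤ (≤-reflexive (sym (card-singleton u)))
                             (≤-reflexive (sym (card-singleton v))))
             (card-+-≤ (_≟ᶠ u) (_≟ᶠ v) (_∈? (E f ∩ E g))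
               (λ { refl → x∈p∩q⁺ (uf , ug) }) (λ { refl → x∈p∩q⁺ (vf , vg) })
               (λ { refl u≡v → u≢v u≡v })))
          (≤-trans (≤-reflexive (sym (∣p∣≡card (E f ∩ E g)))) (linear f g f≢g))

    common-edge-unique : ∀ {f g u v} → u ≢ v → u ∈ E f → v ∈ E f → u ∈ E g → v ∈ E g → f ≡ g
    common-edge-unique {f} {g} u≢v uf vf ug vg = decidable-stable (f ≟ᶠ g) λ f≢g →
      u≢v (common-vertex-unique f≢g uf vf ug vg)

    -- Count pairs of an edge `f` in `S` and a vertex `u` of `f` other than `v`: each `f` has at
    -- least `k` such vertices, and by linearity each neighbour `u` of `v` lies on at most one such
    -- edge.
    star-bound : ∀ v {S : Pred (Fin (size H)) 0ℓ} (S? : Decidable S) k →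
                 (∀ {f} → S f → v ∈ E f × k < ∣ E f ∣) → card S? * k ≤ deg v
    star-bound v {S} S? k S⇒ = begin
      card S? * k                   ≤⟨ double-count R? S? (adj? [ H ]₂ v) k 1 rows columns
                                         (λ {f} (sf , u∈f , v≢u) → v≢u , f , proj₁ (S⇒ sf) , u∈f) ⟩
      card (adj? [ H ]₂ v) * 1      ≡⟨ *-identityʳ _ ⟩
      card (adj? [ H ]₂ v)          ≡⟨ sym (count-tabulate (adj? [ H ]₂ v) id) ⟩
      deg v                         ∎
      where
      open ≤-Reasoning
      R? : Decidable₂ (λ f u → S f × u ∈ E f × v ≢ u)
      R? f u = S? f ×-dec (u ∈? E f) ×-dec ¬? (v ≟ᶠ u)
      rows : ∀ f → S f → k ≤ card (R? f)
      rows f sf = +-cancelʳ-≤ 1 k _ (begin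
        k + 1             ≡⟨ +-comm k 1 ⟩
        suc k             ≤⟨ proj₂ (S⇒ sf) ⟩
        ∣ E f ∣           ≡⟨ ∣p∣≡card (E f) ⟩
        card (_∈? E f)    ≤⟨ card-≤-insert (_∈? E f) (R? f) v (λ u∈f u≢v → sf , u∈f , ≢-sym u≢v) ⟩
        card (R? f) + 1   ∎)
      columns : ∀ u → Adj [ H ]₂ v u → card (λ f → R? f u) ≤ 1
      columns u (v≢u , _) = card-≤1 (λ f → R? f u) λ (sf , uf , _) (sg , ug , _) →
        common-edge-unique v≢u (proj₁ (S⇒ sf)) uf (proj₁ (S⇒ sg)) ug

    -- Structure around an edge where the greedy bound fails

    module Exceptional (e : Fin (size H)) (s : ℕ) (∣e∣≡ : ∣ E e ∣ ≡ 2 + s)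
                       (order≤ : ∀ f → order H ≤ ∣ E f ∣ * ∣ E f ∣)
                       (exceeds : ΔH < card (heavier-neighbour? e)) where

      card-e : card (_∈? E e) ≡ 2 + s
      card-e = trans (sym (∣p∣≡card (E e))) ∣e∣≡

      -- As `v` runs over the vertices of `e`, these sets cover the heavier neighbours of `e`.
      Other : Fin (order H) → Pred (Fin (size H)) 0ℓ
      Other v f = v ∈ E f × f ≢ e × ∣ E e ∣ ≤ ∣ E f ∣

      other? : ∀ v → Decidable (Other v)
      other? v f = (v ∈? E f) ×-dec ¬? (f ≟ᶠ e) ×-dec (∣ E e ∣ ≤? ∣ E f ∣)

      -- The summand 1 is `e`, which lies in the star of `v` too.
      other-bound : ∀ {v} → v ∈ E e → (card (other? v) + 1) * (1 + s) ≤ deg v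
      other-bound {v} v∈e = ≤-trans
        (*-monoˡ-≤ (1 + s) (card-insert-≤ (other? v) star? e
          (λ (v∈f , _ , e≤f) → v∈f , e≤f) (v∈e , ≤-refl) (λ (_ , e≢e , _) → e≢e refl)))
        (star-bound v star? (1 + s) λ (v∈f , e≤f) → v∈f , ≤-trans (≤-reflexive (sym ∣e∣≡)) e≤f)
        where star? = λ f → (v ∈? E f) ×-dec (∣ E e ∣ ≤? ∣ E f ∣)

      -- A union bound, applied below with `Q` all of `e` and with `Q` equal to `e` minus one
      -- vertex.
      cover-bound : {M : Pred (Fin (size H)) 0ℓ} {Q : Pred (Fin (order H)) 0ℓ}
                    (M? : Decidable M) (Q? : Decidable Q) (k : ℕ) →
                    (∀ v → Q v → card (other? v) ≤ k) →
                    (∀ f → M f → ∃ λ v → Q v × Other v f) →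
                    card M? ≤ card Q? * k
      cover-bound M? Q? k ≤k cover = subst (_≤ card Q? * k) (*-identityʳ _)
        (double-count R? M? Q? 1 k
          (λ f mf → let v , r = cover f mf in card-≥1 (R? f) v r)
          (λ v qv → ≤-trans (card-mono (λ f → R? f v) (other? v) proj₂) (≤k v qv))
          proj₁)
        where R? = λ f v → Q? v ×-dec other? v f

      -- The quotient bounds the number of edges of size at least r = 2 + s through a vertex of `e`;
      -- `pred` discards `e`.
      D : ℕ
      D = pred (ΔH / (1 + s))

      other≤quotient : ∀ {v} → v ∈ E e → card (other? v) + 1 ≤ ΔH / (1 + s)
      other≤quotient {v} v∈e = ≤-trans (≤-reflexive (sym (m*n/n≡m (card (other? v) + 1) (1 + s))))
        (/-monoˡ-≤ (1 + s) (≤-trans (other-bound v∈e) (deg≤Δ v)))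

      other≤D : ∀ v → v ∈ E e → card (other? v) ≤ D
      other≤D v v∈e = pred-mono-≤ (≤-trans (≤-reflexive (+-comm 1 _)) (other≤quotient v∈e))

      neighbours≤ : card (heavier-neighbour? e) ≤ (2 + s) * D
      neighbours≤ = subst (λ r → card (heavier-neighbour? e) ≤ r * D) card-e
        (cover-bound (heavier-neighbour? e) (_∈? E e) D other≤D
          λ f ((e≢f , v , v∈e , v∈f) , e≤f) → v , v∈e , v∈f , ≢-sym e≢f , e≤f)

      equalities : D ≡ 2 + s × order H ≡ (2 + s) * (2 + s) × ΔH + 1 ≡ order H
      equalities = tight s D exceeds neighbours≤ 1+D≤ Δ+1≤order
        (subst (λ r → order H ≤ r * r) ∣e∣≡ (order≤ e))
        where
        -- The edge `e` is counted by the quotient, so the `pred` in `D` does not truncate.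
        quotient>0 : 0 < ΔH / (1 + s)
        quotient>0 = ≤-trans (m≤n+m 1 _) (other≤quotient (proj₂ (edge-nonempty H e)))
        1+D≤ : (1 + D) * (1 + s) ≤ ΔH
        1+D≤ = ≤-trans
          (≤-reflexive (cong (_* (1 + s)) (suc-pred (ΔH / (1 + s)) ⦃ >-nonZero quotient>0 ⦄)))
          (m/n*n≤m ΔH (1 + s))
        Δ+1≤order : ΔH + 1 ≤ order H
        Δ+1≤order = ≤-trans (≤-reflexive (+-comm ΔH 1))
          -- A vertex of `e` shows that the order is positive, without which the default maximum 0
          -- would violate the bound.
          (foldr-⊔-< deg (≤-<-trans z≤n (toℕ<n (proj₁ (edge-nonempty H e))))
            λ v → ≤-trans (≤-reflexive (+-comm 1 _)) (deg+1≤order v))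

      order≡ : order H ≡ (2 + s) * (2 + s)
      order≡ = proj₁ (proj₂ equalities)

      other≤ : ∀ v → v ∈ E e → card (other? v) ≤ 2 + s
      other≤ v v∈e = subst (card (other? v) ≤_) (proj₁ equalities) (other≤D v v∈e)

      neighbours≤Δ+1 : card (heavier-neighbour? e) ≤ suc ΔH
      neighbours≤Δ+1 = begin
        card (heavier-neighbour? e)   ≤⟨ neighbours≤ ⟩
        (2 + s) * D                   ≡⟨ cong ((2 + s) *_) (proj₁ equalities) ⟩
        (2 + s) * (2 + s)             ≡⟨ sym order≡ ⟩
        order H                       ≡⟨ sym (proj₂ (proj₂ equalities)) ⟩
        ΔH + 1                        ≡⟨ +-comm ΔH 1 ⟩
        suc ΔH                        ∎
        where open ≤-Reasoning

      deg+1≤ : ∀ v → deg v + 1 ≤ (2 + s) * (2 + s)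
      deg+1≤ v = subst (deg v + 1 ≤_) order≡ (deg+1≤order v)

      -- With r = 2 + s, the heavier neighbours of `e` avoiding `w` are covered by r - 1 sets of
      -- size at most r. As there are at least Δ + 1 = r² heavier neighbours, at least r must pass
      -- through `w`.
      other≥ : ∀ v → v ∈ E e → 2 + s ≤ card (other? v)
      other≥ w w∈e = +-cancelˡ-≤ ((1 + s) * (2 + s)) (2 + s) _ (begin
        (1 + s) * (2 + s) + (2 + s)                 ≡⟨ +-comm _ (2 + s) ⟩
        (2 + s) * (2 + s)                           ≡⟨ sym order≡ ⟩
        order H                                     ≡⟨ sym (proj₂ (proj₂ equalities)) ⟩
        ΔH + 1                                      ≡⟨ +-comm ΔH 1 ⟩
        suc ΔH                                      ≤⟨ exceeds ⟩
        card (heavier-neighbour? e)                 ≤⟨ card-≤-+ (heavier-neighbour? e) M? (other? w) split ⟩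
        card M? + card (other? w)                   ≤⟨ +-monoˡ-≤ _ (cover-bound M? Q? (2 + s)
                                                         (λ v (v∈e , _) → other≤ v v∈e) cover) ⟩
        card Q? * (2 + s) + card (other? w)         ≤⟨ +-monoˡ-≤ _ (*-monoˡ-≤ (2 + s) Q≤) ⟩
        (1 + s) * (2 + s) + card (other? w)         ∎)
        where
        open ≤-Reasoning
        M? = λ f → heavier-neighbour? e f ×-dec ¬? (w ∈? E f)
        Q? = λ v → (v ∈? E e) ×-dec ¬? (v ≟ᶠ w)
        split : ∀ {f} → Conflict e f × ∣ E e ∣ ≤ ∣ E f ∣ →
                ((Conflict e f × ∣ E e ∣ ≤ ∣ E f ∣) × ¬ w ∈ E f) ⊎ Other w f
        split {f} nf@((e≢f , _) , e≤f) with w ∈? E f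
        ... | yes w∈f = inj₂ (w∈f , ≢-sym e≢f , e≤f)
        ... | no  w∉f = inj₁ (nf , w∉f)
        cover : ∀ f → (Conflict e f × ∣ E e ∣ ≤ ∣ E f ∣) × ¬ w ∈ E f →
                ∃ λ v → (v ∈ E e × v ≢ w) × Other v f
        cover f (((e≢f , v , v∈e , v∈f) , e≤f) , w∉f) =
          v , (v∈e , λ { refl → w∉f v∈f }) , v∈f , ≢-sym e≢f , e≤f
        Q≤ : card Q? ≤ 1 + s
        Q≤ = +-cancelʳ-≤ 1 _ _ (begin
          card Q? + 1       ≤⟨ card-insert-≤ Q? (_∈? E e) w proj₁ w∈e (λ (_ , w≢w) → w≢w refl) ⟩
          card (_∈? E e)    ≡⟨ card-e ⟩
          2 + s             ≡⟨ +-comm 1 (1 + s) ⟩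
          1 + s + 1         ∎)

      -- With `e`, at least r + 1 edges of size at least r = 2 + s pass through `v`, so its degree
      -- is at least r² - 1 = |V| - 1 and no other vertex can be missed.
      joined : ∀ {v w} → v ∈ E e → v ≢ w → ∃ λ f → v ∈ E f × w ∈ E f
      joined {v} {w} v∈e v≢w = decidable-stable
        (any? λ f → (v ∈? E f) ×-dec (w ∈? E f)) λ ¬joined → <-irrefl refl (begin-strict
          (2 + s) * (2 + s)                         ≡⟨ square-of-2+ s ⟩
          (3 + s) * (1 + s) + 1                     ≡⟨ cong (λ k → k * (1 + s) + 1) (+-comm 1 (2 + s)) ⟩
          (2 + s + 1) * (1 + s) + 1                 ≤⟨ +-monoˡ-≤ 1 (*-monoˡ-≤ (1 + s) (+-monoˡ-≤ 1 (other≥ v v∈e))) ⟩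
          (card (other? v) + 1) * (1 + s) + 1       ≤⟨ +-monoˡ-≤ 1 (other-bound v∈e) ⟩
          deg v + 1                                 ≡⟨ cong (_+ 1) (count-tabulate (adj? [ H ]₂ v) id) ⟩
          card (adj? [ H ]₂ v) + 1                  <⟨ ≤-reflexive (+-comm 1 _) ⟩
          card (adj? [ H ]₂ v) + 1 + 1              ≤⟨ card-missing₂ (adj? [ H ]₂ v) v w v≢w
                                                         (λ (v≢v , _) → v≢v refl) (λ (_ , j) → ¬joined j) ⟩
          order H                                   ≡⟨ order≡ ⟩
          (2 + s) * (2 + s)                         ∎)
        where open ≤-Reasoning

      -- A smaller edge would violate |V| ≤ |f|². Hence every neighbour of `e` counts as heavier.
      e-smallest : ∀ f → 2 + s ≤ ∣ E f ∣
      e-smallest f = ≮⇒≥ λ f<e → <⇒≱ (*-mono-< f<e f<e) (subst (_≤ ∣ E f ∣ * ∣ E f ∣) order≡ (order≤ f))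

      ∣e∣≤ : ∀ f → ∣ E e ∣ ≤ ∣ E f ∣
      ∣e∣≤ f = subst (_≤ ∣ E f ∣) (sym ∣e∣≡) (e-smallest f)

      -- A common vertex would lie on g, h and the 2 + s edges joining it to
      -- the vertices of e, more than its degree allows.
      parallel-disjoint : ∀ {g h} → g ≢ h → ¬ Meets g e → ¬ Meets h e → ¬ Meets g h
      parallel-disjoint {g} {h} g≢h g∥e h∥e (w , w∈g , w∈h) = <-irrefl refl (begin-strict
        3 + s                             <⟨ n<1+n (3 + s) ⟩
        4 + s                             ≡⟨ +-comm 2 (2 + s) ⟩
        2 + s + 2                         ≡⟨ sym (+-assoc (2 + s) 1 1) ⟩
        2 + s + 1 + 1                     ≡⟨ cong (λ k → k + 1 + 1) (sym card-e) ⟩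
        card (_∈? E e) + 1 + 1            ≤⟨ +-monoˡ-≤ 1 (+-monoˡ-≤ 1 joining≤) ⟩
        card joining? + 1 + 1             ≤⟨ +-monoˡ-≤ 1 (card-insert-≤ joining? joining∪g? g inj₁ (inj₂ refl)
                                               (g∥e ∘ proj₂)) ⟩
        card joining∪g? + 1               ≤⟨ card-insert-≤ joining∪g? (λ f → w ∈? E f) h
                                               (λ { (inj₁ (w∈f , _)) → w∈f ; (inj₂ refl) → w∈g }) w∈h
                                               (λ { (inj₁ (_ , h⋈e)) → h∥e h⋈e ; (inj₂ h≡g) → g≢h (sym h≡g) }) ⟩
        card (λ f → w ∈? E f)             ≤⟨ star-size s _ (≤-trans
                                               (+-monoˡ-≤ 1 (star-bound w (λ f → w ∈? E f) (1 + s)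
                                                 λ {f} w∈f → w∈f , e-smallest f))
                                               (deg+1≤ w)) ⟩
        3 + s                             ∎)
        where
        open ≤-Reasoning
        joining? = λ f → (w ∈? E f) ×-dec meets? f e
        joining∪g? = λ f → joining? f ⊎-dec (f ≟ᶠ g)
        w≢ : ∀ {v} → v ∈ E e → v ≢ w
        w≢ v∈e refl = g∥e (w , w∈g , v∈e)
        -- An edge through `w` is not `e`, so it has at most one vertex on `e`; different vertices
        -- of `e` are joined to `w` by different edges.
        joining≤ : card (_∈? E e) ≤ card joining?
        joining≤ = double-count₁ (λ v f → (v ∈? E e) ×-dec (v ∈? E f) ×-dec (w ∈? E f))
          (_∈? E e) joining?
          (λ v v∈e → let f , v∈f , w∈f = joined v∈e (w≢ v∈e) in f , v∈e , v∈f , w∈f)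
          (λ (ue , uf , wf) (ve , vf , _) →
            common-vertex-unique (λ { refl → w≢ wf refl }) ue ve uf vf)
          (λ {v} (v∈e , v∈f , w∈f) → w∈f , v , v∈f , v∈e)

      second-vertex : ∀ v → ∃ λ u → u ∈ E e × u ≢ v
      second-vertex v = decidable-stable (any? λ u → (u ∈? E e) ×-dec ¬? (u ≟ᶠ v)) λ none →
        <⇒≱ (s≤s (s≤s z≤n)) (subst (_≤ 1) card-e (card-≤1 (_∈? E e)
          λ {i} {j} i∈e j∈e → trans (≡v none i∈e) (sym (≡v none j∈e))))
        where
        ≡v : ¬ (∃ λ u → u ∈ E e × u ≢ v) → ∀ {i} → i ∈ E e → i ≡ v
        ≡v none {i} i∈e = decidable-stable (i ≟ᶠ v) λ i≢v → none (i , i∈e , i≢v)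

      -- Otherwise each of the 2 + s other edges through v meets all 2 + s other
      -- edges through u, so has more than 2 + s vertices, and v has too many neighbours.
      disjoint-others : ∀ {u v} → u ∈ E e → v ∈ E e → u ≢ v →
                        ∃ λ f → ∃ λ g → Other v f × Other u g × ¬ Meets f g
      disjoint-others {u} {v} u∈e v∈e u≢v = decidable-stable
        (any? λ f → any? λ g → other? v f ×-dec other? u g ×-dec ¬? (meets? f g)) λ none →
        <-irrefl refl (begin-strict
          (2 + s) * (2 + s)           ≤⟨ *-monoˡ-≤ (2 + s) (other≥ v v∈e) ⟩
          card (other? v) * (2 + s)   ≤⟨ star-bound v (other? v) (2 + s)
                                           (λ {f} o → proj₁ o , large f o λ g p →
                                             decidable-stable (meets? f g) λ f∥g → none (f , g , o , p , f∥g)) ⟩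
          deg v                       <⟨ ≤-reflexive (+-comm 1 _) ⟩
          deg v + 1                   ≤⟨ deg+1≤ v ⟩
          (2 + s) * (2 + s)           ∎)
        where
        open ≤-Reasoning
        -- The points where `f` meets the edges `g` are distinct because `u` is not on `f`, and
        -- differ from `v` because `v` is not on `g`: an edge containing both `u` and `v` is `e`.
        -- Adding `v` gives the strict inequality.
        large : ∀ f → Other v f → (∀ g → Other u g → Meets f g) → 2 + s < ∣ E f ∣
        large f (v∈f , f≢e , _) meets = begin-strict
          2 + s             ≤⟨ other≥ u u∈e ⟩
          card (other? u)   ≤⟨ double-count₁ (λ g w → other? u g ×-dec (w ∈? E f) ×-dec (w ∈? E g))
                                 (other? u) Q?
                                 (λ g o → let w , w∈f , w∈g = meets g o in w , o , w∈f , w∈g)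
                                 (λ (og , w∈f , w∈g) (oh , _ , w∈h) →
                                   common-edge-unique (λ { refl → f≢e
                                     (common-edge-unique u≢v w∈f v∈f u∈e v∈e) })
                                     (proj₁ og) w∈g (proj₁ oh) w∈h)
                                 (λ ((u∈g , g≢e , _) , w∈f , w∈g) → w∈f , λ { refl → g≢e
                                   (common-edge-unique u≢v u∈g w∈g u∈e v∈e) }) ⟩
          card Q?           <⟨ ≤-trans (≤-reflexive (+-comm 1 _))
                                 (card-insert-≤ Q? (_∈? E f) v proj₁ v∈f (λ (_ , v≢v) → v≢v refl)) ⟩
          card (_∈? E f)    ≡⟨ sym (∣p∣≡card (E f)) ⟩
          ∣ E f ∣           ∎
          where Q? = λ w → (w ∈? E f) ×-dec ¬? (w ≟ᶠ v)

      -- Colouring by classes with a disjoint pair merged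

      module _ {f g u v} (u∈e : u ∈ E e) (v∈e : v ∈ E e) (f∋v : Other v f) (g∋u : Other u g)
               (f∥g : ¬ Meets f g) where

        private
          v∈f = proj₁ f∋v
          u∈g = proj₁ g∋u
          f≢e = proj₁ (proj₂ f∋v)
          g≢e = proj₁ (proj₂ g∋u)

        f≢g : f ≢ g
        f≢g refl = f∥g (v , v∈f , v∈f)

        -- One representative per colour class: `e` stands for the edges disjoint from it, and `f`
        -- for `g`.
        Rep : Pred (Fin (size H)) 0ℓ
        Rep i = i ≢ g × Meets i e
        rep? : Decidable Rep
        rep? i = ¬? (i ≟ᶠ g) ×-dec meets? i e
        -- To the at most Δ + 1 neighbours of `e` one adds `e` and removes `g`.
        rep≤ : card rep? ≤ suc ΔH
        rep≤ = +-cancelʳ-≤ 1 _ _ (begin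
          card rep? + 1                     ≤⟨ card-insert-≤ rep? (λ i → meets? i e) g proj₂
                                                 (u , u∈g , u∈e) (λ (g≢g , _) → g≢g refl) ⟩
          card (λ i → meets? i e)           ≤⟨ card-≤-insert (λ i → meets? i e) (heavier-neighbour? e) e
                                                 (λ {i} (w , w∈i , w∈e) i≢e →
                                                   (≢-sym i≢e , w , w∈e , w∈i) , ∣e∣≤ i) ⟩
          card (heavier-neighbour? e) + 1   ≤⟨ +-monoˡ-≤ 1 neighbours≤Δ+1 ⟩
          suc ΔH + 1                        ∎)
          where open ≤-Reasoning
        -- The complete graph on `Rep`; greedy colouring with constant weight then yields an
        -- injection of `Rep` into the colours.
        distinct? : Decidable₂ (λ i j → Rep i × Rep j × i ≢ j)
        distinct? i j = rep? i ×-dec rep? j ×-dec ¬? (i ≟ᶠ j)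
        open Greedy distinct? (λ (ri , rj , i≢j) → rj , ri , ≢-sym i≢j)
                    (λ i≡j (_ , _ , i≢j) → i≢j i≡j) (const 0) ΔH
        distinct≤ : ∀ i → card (heavier? i) ≤ ΔH
        distinct≤ i = by-cases (rep? i)
          where
          open ≤-Reasoning
          by-cases : Dec (Rep i) → card (heavier? i) ≤ ΔH
          by-cases (no ¬ri) = ≤-trans
            (≤-reflexive (card-empty (heavier? i) λ _ ((ri , _) , _) → ¬ri ri)) z≤n
          by-cases (yes ri) = +-cancelʳ-≤ 1 _ _ (begin
            card (heavier? i) + 1   ≤⟨ card-insert-≤ (heavier? i) rep? i (λ ((_ , rj , _) , _) → rj) ri
                                         (λ ((_ , _ , i≢i) , _) → i≢i refl) ⟩
            card rep?               ≤⟨ rep≤ ⟩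
            suc ΔH                  ≡⟨ +-comm 1 ΔH ⟩
            ΔH + 1                  ∎)

        -- One colour class consists of e and the edges disjoint from it, another of
        -- the disjoint edges f and g; every remaining edge is a class of its own.
        class : ∀ i → Dec (i ≡ g) → Dec (Meets i e) → Fin (size H)
        class i (yes _) _       = f
        class i (no  _) (yes _) = i
        class i (no  _) (no  _) = e

        class-rep : ∀ i (a : Dec (i ≡ g)) (b : Dec (Meets i e)) → Rep (class i a b)
        class-rep i (yes _)   _         = f≢g , v , v∈f , v∈e
        class-rep i (no  i≢g) (yes i⋈e) = i≢g , i⋈e
        class-rep i (no  _)   (no  _)   = ≢-sym g≢e , v , v∈e , v∈e

        -- Two different edges of one class are `f` and `g`, or `e` and an edge disjoint from it, or
        -- two edges disjoint from `e`; none of these pairs meet. With the decisions as arguments,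
        -- `class` reduces in each case.
        class-separates : ∀ i j (a : Dec (i ≡ g)) (b : Dec (Meets i e))
                          (c : Dec (j ≡ g)) (d : Dec (Meets j e)) →
                          Conflict i j → class i a b ≢ class j c d
        class-separates _ _ (yes refl) _         (yes refl) _         (g≢g , _)   _    = g≢g refl
        class-separates _ _ (yes refl) _         (no  _)    (yes _)   (_ , g⋈f)   refl = f∥g (Meets-sym g⋈f)
        class-separates _ _ (yes refl) _         (no  _)    (no  _)   _           eq   = f≢e eq
        class-separates _ _ (no  _)    (yes _)   (yes refl) _         (_ , f⋈g)   refl = f∥g f⋈g
        class-separates _ _ (no  _)    (yes _)   (no  _)    (yes _)   (i≢i , _)   refl = i≢i refl
        class-separates _ _ (no  _)    (yes _)   (no  _)    (no  j∥e) (_ , e⋈j)   refl = j∥e (Meets-sym e⋈j)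
        class-separates _ _ (no  _)    (no  _)   (yes refl) _         _           eq   = f≢e (sym eq)
        class-separates _ _ (no  _)    (no  i∥e) (no  _)    (yes _)   (_ , i⋈e)   refl = i∥e i⋈e
        class-separates _ _ (no  _)    (no  i∥e) (no  _)    (no  j∥e) (i≢j , i⋈j) _    =
          parallel-disjoint i≢j i∥e j∥e i⋈j

        class-colour : EdgeColouring
        class-colour =
          let c , c-injective = colour distinct≤
              class′ = λ i → class i (i ≟ᶠ g) (meets? i e)
              rep′ = λ i → class-rep i (i ≟ᶠ g) (meets? i e)
          in c ∘ class′ , λ i j i⋈j → c-injective (class′ i) (class′ j)
               (rep′ i , rep′ j , class-separates i j (i ≟ᶠ g) (meets? i e) (j ≟ᶠ g) (meets? j e) i⋈j)

      exceptional-colour : EdgeColouring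
      exceptional-colour =
        let v , v∈e = edge-nonempty H e
            u , u∈e , u≢v = second-vertex v
            _ , _ , f∋v , g∋u , f∥g = disjoint-others u∈e v∈e u≢v
        in class-colour u∈e v∈e f∋v g∋u f∥g

    -- Combining the greedy and the exceptional case

    module _ (order≤ : ∀ f → order H ≤ ∣ E f ∣ * ∣ E f ∣) where

      -- The exceptional analysis divides by r - 1. Size 0 contradicts nonemptiness; size 1 forces
      -- |V| ≤ 1, so all edges coincide and `e` has no neighbour to exceed the bound.
      colour-by-size : ∀ e → ΔH < card (heavier-neighbour? e) →
                       ∀ r → ∣ E e ∣ ≡ r → EdgeColouring
      colour-by-size e exceeds (suc (suc s)) ∣e∣≡ =
        Exceptional.exceptional-colour e s ∣e∣≡ order≤ exceeds
      colour-by-size e exceeds zero ∣e∣≡0 = contradiction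
        (≤-trans (card-≥1 (_∈? E e) _ (proj₂ (edge-nonempty H e)))
                 (≤-reflexive (trans (sym (∣p∣≡card (E e))) ∣e∣≡0))) λ ()
      colour-by-size e exceeds (suc zero) ∣e∣≡1 = contradiction exceeds (≤⇒≯ (≤-trans
        (≤-reflexive (card-empty (heavier-neighbour? e)
          λ f ((e≢f , v , v∈e , v∈f) , _) → e≢f (edge-injective H (⊆-antisym
            (λ _ → subst (_∈ E f) (all-equal v _) v∈f)
            (λ _ → subst (_∈ E e) (all-equal v _) v∈e))))) z≤n))
        where
        all-equal : (u v : Fin (order H)) → u ≡ v
        all-equal = Fin-≤1-unique (subst (λ k → order H ≤ k * k) ∣e∣≡1 (order≤ e))

      -- A single failing edge determines enough structure for a direct colouring; greedy is used on
      -- the edges only if it fails nowhere.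
      edge-colouring : EdgeColouring
      edge-colouring = by-cases (any? λ e → ΔH <? card (heavier-neighbour? e))
        where
        by-cases : Dec (∃ λ e → ΔH < card (heavier-neighbour? e)) → EdgeColouring
        by-cases (yes (e , exceeds)) = colour-by-size e exceeds _ refl
        by-cases (no  none)          = greedy-colour λ e → ≮⇒≥ λ exceeds → none (e , exceeds)

theorem1p6 : (H : Hypergraph) → Linear H → antirank H ≥√ order H →
    q H ≤ Δ [ H ]₂ + 1
theorem1p6 H linear antirank≥ = subst (q H ≤_) (+-comm 1 (Δ [ H ]₂))
  (proj₂ (q-isLeast H) (suc (Δ [ H ]₂))
    (proj₁ colouring , λ i j i≢j (v , v∈∩) → proj₂ colouring i j (i≢j , v , x∈p∩q⁻ _ _ v∈∩)))
  where
  colouring = edge-colouring H linear λ f →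
    [≤]-injective (foldr-⊓∞-≥√ (λ i → [ ∣ edge H i ∣ ]) antirank≥ f)
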